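{- For any graph $G$ without isolated vertices and any nontrivial graph $H$, $$\gamma_R^p(G\circ H)\ge \gamma(G)\,\min\{|V(H)|-\Delta(H)+1,\ 2+\delta(H)\}.$$
   Context: All graphs are finite, simple and undirected; a graph is nontrivial if it has at least two vertices. $\delta(H)$ and $\Delta(H)$ are the minimum and maximum degrees of $H$. $\gamma(G)$ is the minimum size of a dominating set (a set $S$ such that every vertex outside $S$ has a neighbour in $S$). A perfect Roman dominating function (PRDF) on a graph $\Gamma$ is a function $f:V(\Gamma)\to\{0,1,2\}$ such that every vertex $u$ with $f(u)=0$ is adjacent to exactly one vertex $v$ with $f(v)=2$. Its weight is $\sum_v f(v)$, and $\gamma_R^p(\Gamma)$ is the minimum weight of a PRDF on $\Gamma$. The lexicographic product $G\circ H$ has vertex set $V(G)\times V(H)$, with $(u,v)$ adjacent to $(x,y)$ iff $ux\in E(G)$, or $u=x$ and $vy\in E(H)$. -}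

module Defs where

open import Data.Fin.Base using (Fin; toℕ; remQuot)
open import Data.Fin.Patterns using (0F; 1F; 2F)
open import Data.Fin.Properties using (_≟_; any?; all?)
open import Data.Fin.Subset using (Subset; inside; outside; ⊤; _∈_; _∉_; ∣_∣)
open import Data.Fin.Subset.Properties using (_∈?_)
open import Data.List.Base as List using (List; []; _∷_; [_]; allFin; cartesianProductWith; filter)
open import Data.List.Extrema.Nat using (min; max)
open import Data.Nat.Base using (ℕ; zero; suc; _+_; _*_; _≤_)
open import Data.Product.Base using (∃; _×_; _,_)
open import Data.Product using (∃!)
open import Data.Sum.Base as Sum using (_⊎_; inj₁; inj₂)
open import Data.Vec.Base as Vec using (Vec; []; _∷_; lookup; replicate; tabulate)
open import Level using (0ℓ)
open import Relation.Binary.Core using (Rel)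
open import Relation.Binary.Definitions using (Decidable; Symmetric; Irreflexive)
open import Relation.Binary.PropositionalEquality.Core using (_≡_; refl; sym)
open import Relation.Nullary.Decidable using (Dec; does; map′; ¬?; _×-dec_; _⊎-dec_; _→-dec_)

-- Finite simple undirected graphs of order n.  Decidability of adjacency is
-- part of what it means, constructively, for the graph to be finite.
record Graph (n : ℕ) : Set₁ where
  field
    Adj    : Rel (Fin n) 0ℓ
    adj?   : Decidable Adj
    symm   : Symmetric Adj
    irrefl : Irreflexive _≡_ Adj

open Graph public

NoIsolatedVertices : ∀ {n} → Graph n → Set
NoIsolatedVertices G = ∀ u → ∃ λ v → Adj G u v

Nontrivial : ∀ {n} → Graph n → Set
Nontrivial {n} _ = 2 ≤ n

neighbourhood : ∀ {n} → Graph n → Fin n → Subset n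
neighbourhood G v = tabulate λ u → does (adj? G v u)

degree : ∀ {n} → Graph n → Fin n → ℕ
degree G v = ∣ neighbourhood G v ∣

-- The first argument of min/max is the value for the empty list.  It does not
-- affect the result when n ≥ 1, since 0 ≤ degree G v < n for every v.
δ : ∀ {n} → Graph n → ℕ
δ {n} G = min n (List.map (degree G) (allFin n))

Δ : ∀ {n} → Graph n → ℕ
Δ {n} G = max 0 (List.map (degree G) (allFin n))

allVecs : ∀ {A : Set} → List A → ∀ n → List (Vec A n)
allVecs xs zero    = [ [] ]
allVecs xs (suc n) = cartesianProductWith _∷_ xs (allVecs xs n)

Dominating : ∀ {n} → Graph n → Subset n → Set
Dominating G S = ∀ v → v ∉ S → ∃ λ u → u ∈ S × Adj G v u

dominating? : ∀ {n} (G : Graph n) (S : Subset n) → Dec (Dominating G S)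
dominating? G S =
  all? λ v → ¬? (v ∈? S) →-dec any? λ u → (u ∈? S) ×-dec adj? G v u

-- The whole vertex set ⊤ is dominating, so taking its size as the starting
-- value of the minimum adds nothing to the set being minimised over.
γ : ∀ {n} → Graph n → ℕ
γ {n} G =
  min ∣ ⊤ {n} ∣
      (List.map ∣_∣ (filter (dominating? G) (allVecs (inside ∷ outside ∷ []) n)))

IsPRDF : ∀ {n} → Graph n → Vec (Fin 3) n → Set
IsPRDF G f =
  ∀ u → lookup f u ≡ 0F → ∃! _≡_ λ v → Adj G u v × lookup f v ≡ 2F

isPRDF? : ∀ {n} (G : Graph n) (f : Vec (Fin 3) n) → Dec (IsPRDF G f)
isPRDF? G f = all? λ u → (lookup f u ≟ 0F) →-dec any? λ v →
    two? u v ×-dec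
    map′ (λ h {w} → h w) (λ h w → h {w}) (all? λ w → two? u w →-dec (v ≟ w))
  where
  two? : ∀ u v → Dec (Adj G u v × lookup f v ≡ 2F)
  two? u v = adj? G u v ×-dec (lookup f v ≟ 2F)

weight : ∀ {n} → Vec (Fin 3) n → ℕ
weight f = Vec.sum (Vec.map toℕ f)

-- The constant function 1 is a PRDF, so, as for γ, starting the minimum from
-- its weight adds nothing.
γᴿᵖ : ∀ {n} → Graph n → ℕ
γᴿᵖ {n} G =
  min (weight (replicate n 1F))
      (List.map weight (filter (isPRDF? G) (allVecs (allFin 3) n)))

-- Fin (m * n) plays the role of V(G) × V(H), through the bijection
-- remQuot n : Fin (m * n) → Fin m × Fin n (with inverse combine).
module _ {m n : ℕ} (G : Graph m) (H : Graph n) where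

  LexAdj : Rel (Fin m × Fin n) 0ℓ
  LexAdj (u , v) (x , y) = Adj G u x ⊎ (u ≡ x × Adj H v y)

  lexAdj? : Decidable LexAdj
  lexAdj? (u , v) (x , y) = adj? G u x ⊎-dec ((u ≟ x) ×-dec adj? H v y)

  lexAdj-sym : Symmetric LexAdj
  lexAdj-sym = Sum.map (symm G) λ (u≡x , vy) → sym u≡x , symm H vy

  lexAdj-irrefl : Irreflexive _≡_ LexAdj
  lexAdj-irrefl refl (inj₁ uu)       = irrefl G refl uu
  lexAdj-irrefl refl (inj₂ (_ , vv)) = irrefl H refl vv

infixr 9 _∘_

_∘_ : ∀ {m n} → Graph m → Graph n → Graph (m * n)
_∘_ {m} {n} G H = record
  { Adj    = λ i j → LexAdj G H (remQuot n i) (remQuot n j)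
  ; adj?   = λ i j → lexAdj? G H (remQuot n i) (remQuot n j)
  ; symm   = lexAdj-sym G H
  ; irrefl = λ { refl → lexAdj-irrefl G H refl }
  }

{-# OPTIONS --safe #-}

-- Let k be the minimum in the bound and call a vertex u of G heavy when its
-- copy H_u of H has weight at least k.  A copy without zeros is heavy, as k ≤ n.
-- If some zero in H_y with y ~ x sees a 2 at (x , b), then b carries the only 2
-- of H_x, and H_x is heavy: either some copy adjacent to H_x contains a 2, and
-- then no neighbour of b in H_x can be 0 (weight ≥ 2 + δ), or the zeros of H_x
-- are all neighbours of b (weight ≥ n − Δ + 1).  Hence every u is heavy or has a
-- heavy neighbour: given a zero of H_u whose 2 lies in H_x with x ≠ u, x is
-- heavy; if it lies in H_u, then for any neighbour y of u either H_y has no zero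
-- and y is heavy, or u is heavy.  So the heavy vertices dominate G, and each
-- contributes at least k to the weight.
module Submission where

open import Defs
open import Data.Bool.Base using (true; false)
open import Data.Fin.Base using (Fin; toℕ; combine; remQuot)
open import Data.Fin.Patterns using (0F; 1F; 2F)
open import Data.Fin.Properties
  using (_≟_; any?; remQuot-combine; combine-remQuot; combine-injective)
open import Data.Fin.Subset
  using (Subset; inside; outside; ⊤; _∈_; _∉_; ∣_∣; ∁; _∪_; ⁅_⁆)
open import Data.Fin.Subset.Properties
  using ( ∣⊤∣≡n; ∣∁p∣≡n∸∣p∣; x∉p⇒x∈∁p; x∈∁p⇒x∉p; p⊂q⇒∣p∣<∣q∣
        ; p⊆p∪q; q⊆p∪q; x∈p∪q⁻; x∈⁅x⁆; x∈⁅y⁆⇒x≡y)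
open import Data.List.Base using (List; []; _∷_; allFin)
open import Data.List.Extrema.Nat using (min≤v⁺; v≤min⁺; v≤max⁺)
open import Data.List.Membership.Propositional using () renaming (_∈_ to _∈ˡ_)
open import Data.List.Membership.Propositional.Properties
  using (∈-allFin; ∈-map⁺; ∈-filter⁺; ∈-cartesianProductWith⁺)
import Data.List.Relation.Unary.All as All
import Data.List.Relation.Unary.All.Properties as All
open import Data.List.Relation.Unary.Any as Any using (here; there)
open import Data.Nat.Base
  using (ℕ; zero; suc; _+_; _∸_; _*_; _⊓_; _≤_; _≥_; z≤n; s≤s; _≤ᵇ_)
open import Data.Nat.Properties
  using ( ≤-reflexive; ≤-trans; _≤?_; ≤ᵇ⇒≤; +-comm; +-mono-≤; m≤n⇒m≤o+n
        ; *-monoˡ-≤; ∸-monoʳ-≤; m∸n≤m; m⊓n≤m; m⊓n≤n; module ≤-Reasoning)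
open import Data.Product.Base using (∃; _×_; _,_; proj₁; proj₂; uncurry)
open import Data.Sum.Base using (_⊎_; inj₁; inj₂)
open import Data.Vec.Base as Vec
  using (Vec; []; _∷_; lookup; replicate; concat; group; _++_)
open import Data.Vec.Properties
  using ( lookup-concat; lookup-replicate; lookup-map; lookup∘tabulate
        ; map-++; sum-++; lookup⇒[]=; []=⇒lookup)
open import Function.Base using (case_of_)
open import Relation.Binary.PropositionalEquality
  using (_≡_; _≢_; refl; sym; trans; cong; cong₂; subst; subst₂)
open import Relation.Nullary.Decidable using (yes; no; dec-true; _×-dec_)
open import Relation.Nullary.Negation using (contradiction)

-- Neighbourhoods and degrees.

module _ {n} (G : Graph n) where

  ∈-neighbourhood⁺ : ∀ {v u} → Adj G v u → u ∈ neighbourhood G v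
  ∈-neighbourhood⁺ {v} {u} vu =
    lookup⇒[]= u _ (trans (lookup∘tabulate _ u) (dec-true (adj? G v u) vu))

  ∈-neighbourhood⁻ : ∀ {v u} → u ∈ neighbourhood G v → Adj G v u
  ∈-neighbourhood⁻ {v} {u} u∈N
    with adj? G v u | trans (sym (lookup∘tabulate _ u)) ([]=⇒lookup u∈N)
  ... | yes vu | _ = vu
  ... | no  _  | ()

  δ≤degree : ∀ v → δ G ≤ degree G v
  δ≤degree v = min≤v⁺ n _
    (inj₂ (Any.map (λ eq → ≤-reflexive (sym eq)) (∈-map⁺ (degree G) (∈-allFin v))))

  degree≤Δ : ∀ v → degree G v ≤ Δ G
  degree≤Δ v = v≤max⁺ 0 _
    (inj₂ (Any.map ≤-reflexive (∈-map⁺ (degree G) (∈-allFin v))))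

-- Domination and Roman domination numbers as minima.

∈-allVecs : ∀ {A : Set} {xs : List A} → (∀ x → x ∈ˡ xs) →
            ∀ {n} (ys : Vec A n) → ys ∈ˡ allVecs xs n
∈-allVecs _   []       = here refl
∈-allVecs all (y ∷ ys) = ∈-cartesianProductWith⁺ _∷_ (all y) (∈-allVecs all ys)

γ≤ : ∀ {n} (G : Graph n) {S : Subset n} → Dominating G S → γ G ≤ ∣ S ∣
γ≤ {n} G {S} dom = min≤v⁺ ∣ ⊤ {n} ∣ _ (inj₂ (Any.map (λ eq → ≤-reflexive (sym eq))
  (∈-map⁺ ∣_∣ (∈-filter⁺ (dominating? G) (∈-allVecs ∈-sides S) dom))))
  where
  ∈-sides : ∀ x → x ∈ˡ (inside ∷ outside ∷ [])
  ∈-sides true  = here refl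
  ∈-sides false = there (here refl)

≤γᴿᵖ : ∀ {n} (G : Graph n) {k} →
       (∀ f → IsPRDF G f → k ≤ weight f) → k ≤ γᴿᵖ G
≤γᴿᵖ {n} G k≤ = v≤min⁺
  -- The minimum starts from the weight of the constant 1, a PRDF because it has no zeros, so `k≤`
  -- bounds this value too.
  (k≤ (replicate n 1F) λ u eq → case trans (sym (lookup-replicate u 1F)) eq of λ ())
  (All.map⁺ (All.map (λ {f} → k≤ f) (All.all-filter (isPRDF? G) (allVecs (allFin 3) n))))

-- Weight bounds from sets without zeros.

∣p∣≤weight : ∀ {n} (f : Vec (Fin 3) n) {p} →
             (∀ {v} → v ∈ p → lookup f v ≢ 0F) → ∣ p ∣ ≤ weight f
∣p∣≤weight []       {[]}          _  = z≤n
∣p∣≤weight (x ∷ f)  {outside ∷ p} nz =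
  m≤n⇒m≤o+n (toℕ x) (∣p∣≤weight f λ v∈p → nz (Vec.there v∈p))
∣p∣≤weight (0F ∷ f) {inside ∷ p}  nz = contradiction refl (nz Vec.here)
∣p∣≤weight (1F ∷ f) {inside ∷ p}  nz = s≤s (∣p∣≤weight f λ v∈p → nz (Vec.there v∈p))
∣p∣≤weight (2F ∷ f) {inside ∷ p}  nz =
  s≤s (m≤n⇒m≤o+n 1 (∣p∣≤weight f λ v∈p → nz (Vec.there v∈p)))

-- The vertex `b` counts once in `∣ p ∣` but contributes 2 to the weight; this surplus is the extra
-- 1.
∣p∣<weight : ∀ {n} (f : Vec (Fin 3) n) {p b} → b ∈ p → lookup f b ≡ 2F →
             (∀ {v} → v ∈ p → lookup f v ≢ 0F) → suc ∣ p ∣ ≤ weight f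
∣p∣<weight (2F ∷ f) Vec.here refl nz =
  s≤s (s≤s (∣p∣≤weight f λ v∈p → nz (Vec.there v∈p)))
∣p∣<weight (x ∷ f) {outside ∷ p} (Vec.there b∈p) fb nz =
  m≤n⇒m≤o+n (toℕ x) (∣p∣<weight f b∈p fb λ v∈p → nz (Vec.there v∈p))
∣p∣<weight (0F ∷ f) {inside ∷ p} (Vec.there b∈p) fb nz = contradiction refl (nz Vec.here)
∣p∣<weight (1F ∷ f) {inside ∷ p} (Vec.there b∈p) fb nz =
  s≤s (∣p∣<weight f b∈p fb λ v∈p → nz (Vec.there v∈p))
∣p∣<weight (2F ∷ f) {inside ∷ p} (Vec.there b∈p) fb nz =
  s≤s (m≤n⇒m≤o+n 1 (∣p∣<weight f b∈p fb λ v∈p → nz (Vec.there v∈p)))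

weight-++ : ∀ {m n} (f : Vec (Fin 3) m) (g : Vec (Fin 3) n) →
            weight (f ++ g) ≡ weight f + weight g
weight-++ f g = trans (cong Vec.sum (map-++ toℕ f g)) (sum-++ (Vec.map toℕ f))

-- Counting heavy copies.

module _ {n : ℕ} (k : ℕ) where

  Heavy : Vec (Fin 3) n → Set
  Heavy f = k ≤ weight f

  heavy : ∀ {m} → Vec (Vec (Fin 3) n) m → Subset m
  heavy = Vec.map λ f → k ≤ᵇ weight f

  ∈-heavy⁺ : ∀ {m} (fs : Vec (Vec (Fin 3) n) m) {u} → Heavy (lookup fs u) → u ∈ heavy fs
  ∈-heavy⁺ fs {u} k≤ =
    lookup⇒[]= u _ (trans (lookup-map u _ fs) (dec-true (k ≤? _) k≤))

  ∣heavy∣*k≤weight : ∀ {m} (fs : Vec (Vec (Fin 3) n) m) → ∣ heavy fs ∣ * k ≤ weight (concat fs)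
  ∣heavy∣*k≤weight []       = z≤n
  ∣heavy∣*k≤weight (f ∷ fs) rewrite weight-++ f (concat fs)
    with k ≤ᵇ weight f | ≤ᵇ⇒≤ k (weight f)
  ... | true  | k≤ = +-mono-≤ (k≤ _) (∣heavy∣*k≤weight fs)
  ... | false | _  = m≤n⇒m≤o+n (weight f) (∣heavy∣*k≤weight fs)

-- The two bounds within a single copy of `H`.

copyBound : ∀ {n} → Graph n → ℕ
copyBound {n} H = ((n ∸ Δ H) + 1) ⊓ (2 + δ H)

-- The degree of vertex `0F` lies between `δ H` and `Δ H`. So if `Δ H` is 0, then so is `δ H`, and
-- the second term is 2, at most n by nontriviality; otherwise the first term is at most n.
copyBound≤n : ∀ {n} (H : Graph n) → Nontrivial H → copyBound H ≤ n
copyBound≤n {suc n} H 2≤n with Δ H | ≤-trans (δ≤degree H 0F) (degree≤Δ H 0F)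
... | zero  | δ≤0 = ≤-trans (m⊓n≤n _ _) (≤-trans (s≤s (s≤s δ≤0)) 2≤n)
... | suc d | _   = ≤-trans (m⊓n≤m _ _)
  (≤-trans (≤-reflexive (+-comm (n ∸ d) 1)) (s≤s (m∸n≤m n d)))

module _ {n} (H : Graph n) (f : Vec (Fin 3) n) {b} (fb≡2 : lookup f b ≡ 2F) where

  b∉N : b ∉ neighbourhood H b
  b∉N b∈N = irrefl H refl (∈-neighbourhood⁻ H b∈N)

  -- The closed neighbourhood of `b` has at least 1 + `δ H` vertices, none of value 0, and the value
  -- 2 at `b` adds one more.
  2+δ≤weight : (∀ {v} → Adj H b v → lookup f v ≢ 0F) → 2 + δ H ≤ weight f
  2+δ≤weight nz = begin
    2 + δ H                             ≤⟨ s≤s (s≤s (δ≤degree H b)) ⟩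
    2 + degree H b                      ≤⟨ s≤s (p⊂q⇒∣p∣<∣q∣ (p⊆p∪q ⁅ b ⁆ , b , b∈p , b∉N)) ⟩
    suc ∣ neighbourhood H b ∪ ⁅ b ⁆ ∣   ≤⟨ ∣p∣<weight f b∈p fb≡2 nz′ ⟩
    weight f                            ∎
    where
    open ≤-Reasoning
    b∈p : b ∈ neighbourhood H b ∪ ⁅ b ⁆
    b∈p = q⊆p∪q _ _ (x∈⁅x⁆ b)
    nz′ : ∀ {v} → v ∈ neighbourhood H b ∪ ⁅ b ⁆ → lookup f v ≢ 0F
    nz′ v∈ fv≡0 with x∈p∪q⁻ (neighbourhood H b) ⁅ b ⁆ v∈
    ... | inj₁ v∈N = nz (∈-neighbourhood⁻ H v∈N) fv≡0
    ... | inj₂ v∈b with refl ← x∈⁅y⁆⇒x≡y b v∈b = case trans (sym fb≡2) fv≡0 of λ ()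

  -- All zeros lie in the neighbourhood of `b`, so its complement, of size at least `n ∸ Δ H`, has
  -- none; it contains `b`, whose value 2 gives the extra 1.
  n∸Δ+1≤weight : (∀ {v} → lookup f v ≡ 0F → Adj H b v) → (n ∸ Δ H) + 1 ≤ weight f
  n∸Δ+1≤weight zeros = begin
    (n ∸ Δ H) + 1                   ≡⟨ +-comm (n ∸ Δ H) 1 ⟩
    suc (n ∸ Δ H)                   ≤⟨ s≤s (∸-monoʳ-≤ n (degree≤Δ H b)) ⟩
    suc (n ∸ degree H b)            ≡⟨ cong suc (∣∁p∣≡n∸∣p∣ (neighbourhood H b)) ⟨
    suc ∣ ∁ (neighbourhood H b) ∣   ≤⟨ ∣p∣<weight f (x∉p⇒x∈∁p b∉N) fb≡2 (λ v∈∁N fv≡0 →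
                                         x∈∁p⇒x∉p v∈∁N (∈-neighbourhood⁺ H (zeros fv≡0))) ⟩
    weight f                        ∎
    where open ≤-Reasoning

-- PRDFs on the product, read copy by copy.

module _ {m n} (G : Graph m) (H : Graph n) (fs : Vec (Vec (Fin 3) n) m)
         (prdf : IsPRDF (G ∘ H) (concat fs)) where

  private
    f : Fin m × Fin n → Fin 3
    f (u , v) = lookup (lookup fs u) v

    HeavyCopy : Fin m → Set
    HeavyCopy u = Heavy (copyBound H) (lookup fs u)

    lookup-remQuot : ∀ i → lookup (concat fs) i ≡ f (remQuot n i)
    lookup-remQuot i = trans (cong (lookup (concat fs)) (sym (combine-remQuot {m} n i)))
                             (uncurry (lookup-concat fs) (remQuot n i))

  two-neighbour : ∀ p → f p ≡ 0F → ∃ λ q → LexAdj G H p q × f q ≡ 2F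
  two-neighbour (u , v) fp≡0
    with j , (pj , fj≡2) , _ ← prdf (combine u v) (trans (lookup-concat fs u v) fp≡0)
    = remQuot n j , subst (λ p → LexAdj G H p (remQuot n j)) (remQuot-combine u v) pj
    , trans (sym (lookup-remQuot j)) fj≡2

  -- `combine` carries both vertices into the product, where `∃!` identifies them; its injectivity
  -- carries the equality back.
  two-neighbour-unique : ∀ p → f p ≡ 0F → ∀ {q r} → LexAdj G H p q → f q ≡ 2F →
                         LexAdj G H p r → f r ≡ 2F → q ≡ r
  two-neighbour-unique (u , v) fp≡0 {q} {r} pq fq≡2 pr fr≡2
    with _ , _ , unique ← prdf (combine u v) (trans (lookup-concat fs u v) fp≡0)
    = cong₂ _,_ (proj₁ q≡r) (proj₂ q≡r)
    where
    combined : ∀ {s} → LexAdj G H (u , v) s → f s ≡ 2F →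
               Adj (G ∘ H) (combine u v) (uncurry combine s) ×
               lookup (concat fs) (uncurry combine s) ≡ 2F
    combined {x , y} ps fs≡2 =
      subst₂ (LexAdj G H) (sym (remQuot-combine u v)) (sym (remQuot-combine x y)) ps ,
      trans (lookup-concat fs x y) fs≡2
    q≡r = combine-injective _ _ _ _
      (trans (sym (unique (combined pq fq≡2))) (unique (combined pr fr≡2)))

  heavy-or-zero : Nontrivial H → ∀ u → HeavyCopy u ⊎ ∃ λ v → f (u , v) ≡ 0F
  heavy-or-zero 2≤n u with any? (λ v → f (u , v) ≟ 0F)
  ... | yes ∃zero = inj₂ ∃zero
  ... | no ¬∃zero = inj₁ (begin
    copyBound H           ≤⟨ copyBound≤n H 2≤n ⟩
    n                     ≡⟨ ∣⊤∣≡n n ⟨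
    ∣ ⊤ {n} ∣             ≤⟨ ∣p∣≤weight (lookup fs u) {⊤} (λ {v} _ fv≡0 → ¬∃zero (v , fv≡0)) ⟩
    weight (lookup fs u)  ∎)
    where open ≤-Reasoning

  heavy-next-to-zero : ∀ {x y b c} → Adj G y x → f (y , c) ≡ 0F → f (x , b) ≡ 2F → HeavyCopy x
  heavy-next-to-zero {x} {y} {b} {c} yx fyc≡0 fxb≡2
    with any? (λ z → any? λ a → adj? G x z ×-dec (f (z , a) ≟ 2F))
  ... | yes (z , a , xz , fza≡2) =
    -- A zero at a neighbour `v` of `b` would see the 2s at `(z , a)` and `(x , b)`; uniqueness
    -- would force z = x and make `xz` a loop.
    ≤-trans (m⊓n≤n _ _) (2+δ≤weight H (lookup fs x) fxb≡2 λ {v} bv fxv≡0 →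
      irrefl G (sym (cong proj₁ (two-neighbour-unique (x , v) fxv≡0
        (inj₁ xz) fza≡2 (inj₂ (refl , symm H bv)) fxb≡2))) xz)
  ... | no ¬two = ≤-trans (m⊓n≤m _ _) (n∸Δ+1≤weight H (lookup fs x) fxb≡2 zeros)
    where
    zeros : ∀ {v} → f (x , v) ≡ 0F → Adj H b v
    zeros {v} fxv≡0 with two-neighbour (x , v) fxv≡0
    ... | (z , a) , inj₁ xz , fza≡2 = contradiction (z , a , xz , fza≡2) ¬two
    ... | (x , a) , inj₂ (refl , va) , fxa≡2
      -- The zero at `(y , c)` is adjacent to the whole copy over `x`, so it sees both `(x , a)` and
      -- `(x , b)`; hence a = b.
      with refl ← two-neighbour-unique (y , c) fyc≡0 (inj₁ yx) fxb≡2 (inj₁ yx) fxa≡2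
      = symm H va

  heavy-or-heavy-neighbour : NoIsolatedVertices G → Nontrivial H →
                             ∀ u → HeavyCopy u ⊎ ∃ λ x → HeavyCopy x × Adj G u x
  heavy-or-heavy-neighbour noIsolated 2≤n u with heavy-or-zero 2≤n u
  ... | inj₁ heavyᵤ = inj₁ heavyᵤ
  ... | inj₂ (v , fuv≡0) with two-neighbour (u , v) fuv≡0
  ...   | (x , b) , inj₁ ux , fxb≡2 = inj₂ (x , heavy-next-to-zero ux fuv≡0 fxb≡2 , ux)
  ...   | (u , b) , inj₂ (refl , _) , fub≡2 with y , uy ← noIsolated u | heavy-or-zero 2≤n y
  ...     | inj₁ heavyᵧ      = inj₂ (y , heavyᵧ , uy)
  -- As `y` is adjacent to `u`, the zero in the copy over `y` sees the 2 at `(u , b)`.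
  ...     | inj₂ (_ , fyc≡0) = inj₁ (heavy-next-to-zero (symm G uy) fyc≡0 fub≡2)

  heavy-dominating : NoIsolatedVertices G → Nontrivial H → Dominating G (heavy (copyBound H) fs)
  heavy-dominating noIsolated 2≤n u u∉ with heavy-or-heavy-neighbour noIsolated 2≤n u
  ... | inj₁ heavyᵤ            = contradiction (∈-heavy⁺ (copyBound H) fs heavyᵤ) u∉
  ... | inj₂ (x , heavyₓ , ux) = x , ∈-heavy⁺ (copyBound H) fs heavyₓ , ux

theorem4p7 : ∀ {m n : ℕ} (G : Graph m) (H : Graph n) →
    NoIsolatedVertices G → Nontrivial H →
    γᴿᵖ (G ∘ H) ≥ γ G * (((n ∸ Δ H) + 1) ⊓ (2 + δ H))
theorem4p7 {m} {n} G H noIsolated 2≤n = ≤γᴿᵖ (G ∘ H) bound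
  where
  bound : ∀ f → IsPRDF (G ∘ H) f → γ G * copyBound H ≤ weight f
  -- Every vector of length `m * n` is a concatenation of m rows of length n, one for each copy of
  -- `H`.
  bound f prdf with fs , refl ← group m n f =
    ≤-trans (*-monoˡ-≤ (copyBound H) (γ≤ G (heavy-dominating G H fs prdf noIsolated 2≤n)))
            (∣heavy∣*k≤weight (copyBound H) fs)
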